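{- Let $C_{(\neq,<)}(x,y)$ be the bivariate generating function of the Catalan words avoiding the ordered pair of relations $(\neq,<)$, where $x$ marks the length and $y$ marks the number of descents. Then $$C_{(\neq,<)}(x,y)=\frac{1 - x - x^2 - \sqrt{(1 - x - x^2)^2 - 4 x^3 y}}{2 x^3 y}.$$
   Context: A Catalan word of length $n$ is a word $w=w_1w_2\cdots w_n$ over the non-negative integers with $w_1=0$ and $0\leq w_i\leq w_{i-1}+1$ for $i=2,\dots,n$; the empty word is the unique Catalan word of length $0$. For relations $X,Y\in\{<,>,\leq,\geq,=,\neq\}$, a word $w$ contains the pattern $(X,Y)$ if there is an index $i\geq 1$ (with $i+2\le n$) such that $w_i\,X\,w_{i+1}$ and $w_{i+1}\,Y\,w_{i+2}$; otherwise $w$ avoids $(X,Y)$. The number of descents $\mathrm{des}(w)$ is the number of indices $i$ with $w_i>w_{i+1}$. The bivariate generating function is $C_{(X,Y)}(x,y)=\sum_{w}x^{|w|}y^{\mathrm{des}(w)}$, the sum being over all Catalan words $w$ (of any length $|w|\geq 0$) avoiding $(X,Y)$. Identities are between formal power series in $x$ with coefficients polynomials in $y$ (after clearing denominators); the square root of a power series with constant term $1$ is the one with constant term $1$. -}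

module Defs where

open import Algebra.Bundles using (RawRing)
import Algebra.Definitions.RawSemiring as RawSemiringDefinitions
open import Data.Bool.Base using (if_then_else_)
open import Data.Fin.Base using (toℕ)
open import Data.Integer.Base as ℤ using (ℤ; 0ℤ; 1ℤ)
open import Data.List.Base using (List; []; _∷_; [_]; length; map; filter; foldr; concatMap; upTo)
open import Data.List.Membership.Propositional using (_∈_; find; lose)
open import Data.List.Membership.Propositional.Properties
  using (∈-map⁺; ∈-map⁻; ∈-concatMap⁺; ∈-concatMap⁻; ∈-upTo⁺; ∈-upTo⁻)
open import Data.List.Properties using (∷-injectiveˡ; ∷-injectiveʳ)
open import Data.List.Relation.Binary.Disjoint.Propositional using (Disjoint)
import Data.List.Relation.Unary.All as All
import Data.List.Relation.Unary.All.Properties as All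
import Data.List.Relation.Unary.AllPairs as AllPairs
import Data.List.Relation.Unary.AllPairs.Properties as AllPairs
open import Data.List.Relation.Unary.Any using (here)
open import Data.List.Relation.Unary.Linked using (Linked; [-]; _∷_)
open import Data.List.Relation.Unary.Unique.Propositional using (Unique; []; _∷_)
open import Data.List.Relation.Unary.Unique.Propositional.Properties using (map⁺; upTo⁺; concat⁺)
open import Data.Nat.Base as ℕ using (ℕ; zero; suc; _∸_; _<_; _>_; _≤_; _≥_; s≤s; s≤s⁻¹)
open import Data.Nat.Properties using (_<?_; _>?_; _≤?_; _≥?_; _≟_)
open import Data.Product.Base using (_×_; _,_)
open import Data.Sum.Base using (inj₁; inj₂)
open import Function.Bundles using (_⇔_; mk⇔)
open import Level using (0ℓ)
open import Relation.Binary.Core using (Rel)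
open import Relation.Binary.Definitions using (Decidable)
open import Relation.Binary.PropositionalEquality using (_≡_; _≢_; refl; sym; trans)
open import Relation.Nullary.Decidable using (no; does; map′; ¬?; _×-dec_; _⊎-dec_)
open import Relation.Nullary.Negation using (¬_)
import Relation.Unary as Unary

Word : Set
Word = List ℕ

data IsCatalan : Word → Set where
  empty : IsCatalan []
  start : ∀ {w} → Linked (λ a b → b ≤ suc a) (0 ∷ w) → IsCatalan (0 ∷ w)

-- `continuations a n` lists the words w of length n for which a ∷ w
-- satisfies the growth condition.
continuations : ℕ → ℕ → List Word
continuations a zero    = [ [] ]
continuations a (suc n) = concatMap (λ b → map (b ∷_) (continuations b n)) (upTo (2 ℕ.+ a))

-- The Catalan words of length n, each listed once: see
-- `∈-catalanWords` and `catalanWords-unique`.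
catalanWords : ℕ → List Word
catalanWords zero    = [ [] ]
catalanWords (suc n) = map (0 ∷_) (continuations 0 n)

private
  branch : ℕ → ℕ → List Word
  branch n b = map (b ∷_) (continuations b n)

∈-continuations⁺ : ∀ {a} w → Linked (λ a b → b ≤ suc a) (a ∷ w) → w ∈ continuations a (length w)
∈-continuations⁺ []      _           = here refl
∈-continuations⁺ (b ∷ w) (b≤1+a ∷ l) =
  ∈-concatMap⁺ (branch (length w)) {xs = upTo (2 ℕ.+ _)} (lose (∈-upTo⁺ (s≤s b≤1+a)) (∈-map⁺ (b ∷_) (∈-continuations⁺ w l)))

∈-continuations⁻ : ∀ a n {w} → w ∈ continuations a n →
                   Linked (λ a b → b ≤ suc a) (a ∷ w) × length w ≡ n
∈-continuations⁻ a zero    (here refl) = [-] , refl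
∈-continuations⁻ a (suc n) w∈
  with b , b∈ , w∈′ ← find (∈-concatMap⁻ (branch n) {xs = upTo (2 ℕ.+ a)} w∈)
  with v , v∈ , refl ← ∈-map⁻ (b ∷_) w∈′
  with l , refl ← ∈-continuations⁻ b n v∈
  = (s≤s⁻¹ (∈-upTo⁻ b∈) ∷ l) , refl

∈-catalanWords : ∀ n w → w ∈ catalanWords n ⇔ (IsCatalan w × length w ≡ n)
∈-catalanWords n w = mk⇔ (to n) from
  where
  to : ∀ n {w} → w ∈ catalanWords n → IsCatalan w × length w ≡ n
  to zero    (here refl) = empty , refl
  to (suc n) w∈
    with v , v∈ , refl ← ∈-map⁻ (0 ∷_) w∈
    with l , refl ← ∈-continuations⁻ 0 n v∈
    = start l , refl

  from : ∀ {w n} → IsCatalan w × length w ≡ n → w ∈ catalanWords n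
  from (empty   , refl) = here refl
  from (start l , refl) = ∈-map⁺ (0 ∷_) (∈-continuations⁺ _ l)

continuations-unique : ∀ a n → Unique (continuations a n)
continuations-unique a zero    = All.[] ∷ []
continuations-unique a (suc n) =
  concat⁺
    (All.map⁺ {f = branch n} (All.universal (λ b → map⁺ ∷-injectiveʳ (continuations-unique b n)) (upTo (2 ℕ.+ a))))
    (AllPairs.map⁺ {f = branch n} (AllPairs.map disjoint (upTo⁺ (2 ℕ.+ a))))
  where
  disjoint : ∀ {b c} → b ≢ c →
             Disjoint (branch n b) (branch n c)
  disjoint {b} {c} b≢c (w∈₁ , w∈₂)
    with _ , _ , eq₁ ← ∈-map⁻ (b ∷_) w∈₁
    with _ , _ , eq₂ ← ∈-map⁻ (c ∷_) w∈₂
    = b≢c (∷-injectiveˡ (trans (sym eq₁) eq₂))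

catalanWords-unique : ∀ n → Unique (catalanWords n)
catalanWords-unique zero    = All.[] ∷ []
catalanWords-unique (suc n) = map⁺ ∷-injectiveʳ (continuations-unique 0 n)

data Relation : Set where
  lt gt leq geq eq neq : Relation

⟦_⟧ : Relation → Rel ℕ 0ℓ
⟦ lt  ⟧ = _<_
⟦ gt  ⟧ = _>_
⟦ leq ⟧ = _≤_
⟦ geq ⟧ = _≥_
⟦ eq  ⟧ = _≡_
⟦ neq ⟧ = _≢_

⟦_⟧? : ∀ X → Decidable ⟦ X ⟧
⟦ lt  ⟧? = _<?_
⟦ gt  ⟧? = _>?_
⟦ leq ⟧? = _≤?_
⟦ geq ⟧? = _≥?_
⟦ eq  ⟧? = _≟_
⟦ neq ⟧? = λ a b → ¬? (a ≟ b)

data Contains (X Y : Relation) : Word → Set where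
  here  : ∀ {a b c w} → ⟦ X ⟧ a b → ⟦ Y ⟧ b c → Contains X Y (a ∷ b ∷ c ∷ w)
  there : ∀ {a w} → Contains X Y w → Contains X Y (a ∷ w)

Avoids : Relation → Relation → Word → Set
Avoids X Y w = ¬ Contains X Y w

contains? : ∀ X Y → Unary.Decidable (Contains X Y)
contains? X Y []              = no λ ()
contains? X Y (a ∷ [])        = no λ { (there ()) }
contains? X Y (a ∷ b ∷ [])    = no λ { (there (there ())) }
contains? X Y (a ∷ b ∷ c ∷ w) =
  map′ (λ { (inj₁ (Xab , Ybc)) → here Xab Ybc ; (inj₂ p) → there p })
       (λ { (here Xab Ybc) → inj₁ (Xab , Ybc) ; (there p) → inj₂ p })
       ((⟦ X ⟧? a b ×-dec ⟦ Y ⟧? b c) ⊎-dec contains? X Y (b ∷ c ∷ w))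

avoids? : ∀ X Y → Unary.Decidable (Avoids X Y)
avoids? X Y w = ¬? (contains? X Y w)

des : Word → ℕ
des []          = 0
des (a ∷ [])    = 0
des (a ∷ b ∷ w) = (if does (a >? b) then 1 else 0) ℕ.+ des (b ∷ w)

-- Polynomials are coefficient lists, constant coefficient first.
-- Trailing zeros are allowed, so equality is equality of coefficients.
Polynomial : Set
Polynomial = List ℤ

coeff : Polynomial → ℕ → ℤ
coeff []      k       = 0ℤ
coeff (a ∷ p) zero    = a
coeff (a ∷ p) (suc k) = coeff p k

infixl 6 _+ₚ_
_+ₚ_ : Polynomial → Polynomial → Polynomial
[]      +ₚ q       = q
(a ∷ p) +ₚ []      = a ∷ p
(a ∷ p) +ₚ (b ∷ q) = (a ℤ.+ b) ∷ (p +ₚ q)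

infixl 7 _*ₚ_
_*ₚ_ : Polynomial → Polynomial → Polynomial
[]      *ₚ q = []
(a ∷ p) *ₚ q = map (a ℤ.*_) q +ₚ (0ℤ ∷ (p *ₚ q))

ℤ[y] : RawRing 0ℓ 0ℓ
ℤ[y] = record
  { Carrier = Polynomial
  ; _≈_     = λ p q → ∀ k → coeff p k ≡ coeff q k
  ; _+_     = _+ₚ_
  ; _*_     = _*ₚ_
  ; -_      = map (λ a → ℤ.- a)
  ; 0#      = []
  ; 1#      = [ 1ℤ ]
  }

indeterminate : Polynomial
indeterminate = 0ℤ ∷ 1ℤ ∷ []

module PowerSeries {c ℓ} (R : RawRing c ℓ) where

  private
    module R = RawRing R
  open RawSemiringDefinitions R.rawSemiring using (sum)

  Series : Set c
  Series = ℕ → R.Carrier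

  constant : R.Carrier → Series
  constant r zero    = r
  constant r (suc n) = R.0#

  variable# : Series
  variable# 1 = R.1#
  variable# _ = R.0#

  rawRing : RawRing c ℓ
  rawRing = record
    { Carrier = Series
    ; _≈_     = λ f g → ∀ n → f n R.≈ g n
    ; _+_     = λ f g n → f n R.+ g n
    ; _*_     = λ f g n → sum {suc n} λ i → f (toℕ i) R.* g (n ∸ toℕ i)
    ; -_      = λ f n → R.- f n
    ; 0#      = constant R.0#
    ; 1#      = constant R.1#
    }

  -- s is the square root of f having constant term 1.
  IsSqrt : Series → Series → Set ℓ
  IsSqrt s f = s 0 R.≈ R.1# × s * s ≈ f
    where open RawRing rawRing using (_*_; _≈_)

open PowerSeries ℤ[y] public using (Series; IsSqrt)

ℤ[y]⟦x⟧ : RawRing 0ℓ 0ℓ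
ℤ[y]⟦x⟧ = PowerSeries.rawRing ℤ[y]

open RawRing ℤ[y]⟦x⟧ public using (_≈_; _+_; _*_; -_; 0#; 1#)

-- k · f is the k-fold sum f + ⋯ + f.
open RawSemiringDefinitions (RawRing.rawSemiring ℤ[y]⟦x⟧) public
  using (_^_) renaming (_×_ to _·_)

infixl 6 _-_
_-_ : Series → Series → Series
f - g = f + (- g)

x y : Series
x = PowerSeries.variable# ℤ[y]
y = PowerSeries.constant ℤ[y] indeterminate

-- The coefficient of xⁿ is the sum of y^des(w) over the Catalan words w
-- of length n that avoid (X , Y).
C : Relation → Relation → Series
C X Y n = foldr (λ w p → indeterminate ^ₚ des w +ₚ p) [] (filter (avoids? X Y) (catalanWords n))
  where open RawSemiringDefinitions (RawRing.rawSemiring ℤ[y]) renaming (_^_ to _^ₚ_)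

{-# OPTIONS --safe #-}

-- Let G a enumerate the words that may follow a letter a when the next
-- step must not be an ascent, and F a those with no such restriction.
-- Splitting off the next letter gives F a = G a + x G (a + 1) and
-- G a = 1 + x (F a + y ∑_{b < a} G b); in particular G 0 = 1 + x F 0 = C.
-- This system determines the family G.  Both G (a + 1) and
-- G a · (1 + x y G 0) solve it with 1 replaced by 1 + x y G 0, so they
-- agree, and for a = 0 the system becomes C = 1 + (x + x²) C + x³ y C².
-- Hence 1 - x - x² - 2 x³ y C is a square root of the discriminant, and
-- it is the only one with constant term 1 as ℤ[y] has no 2-torsion.
module Submission where

open import Defs using (module PowerSeries; Word; continuations; catalanWords; des; neq; lt; contains?; avoids?;
  Polynomial; coeff; _+ₚ_; _*ₚ_; ℤ[y]; indeterminate)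
open import Algebra.Bundles using (CommutativeRing; RawRing)
import Algebra.Construct.Pointwise as Pointwise
import Algebra.Definitions.RawSemiring as RawSemiringDefinitions
import Algebra.Morphism.RingMonomorphism as RingMonomorphism
open import Algebra.Morphism.Structures using (IsRingMonomorphism)
import Algebra.Properties.Group as GroupProperties
import Algebra.Properties.Monoid.Sum as MonoidSum
import Algebra.Properties.Semiring.Sum as SemiringSum
import Algebra.Solver.Ring.NaturalCoefficients.Default as RingSolver
open import Algebra.Structures using (IsCommutativeRing)
open import Data.Bool.Base using (true; false; if_then_else_)
open import Data.Fin.Base as Fin using (Fin; toℕ)
open import Data.Integer.Base as ℤ using (ℤ; 0ℤ)
import Data.Integer.Properties as ℤ
open import Data.List.Base using (List; []; _∷_; [_]; _++_; map; filter; foldr; concatMap; applyUpTo; upTo)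
open import Data.List.Properties using (upTo-∷ʳ)
open import Data.Nat.Base as ℕ using (ℕ; zero; suc; z≤n; s≤s; z<s; s<s; _≤_; _<_; _≮_)
open import Data.Nat.Induction using (<-rec)
open import Data.Nat.Properties
  using (≤-refl; <-trans; ≤-<-trans; m≤n⇒m≤1+n; <-irrefl; <-asym; <⇒≢; >⇒≢; _<?_; _≟_)
open import Data.Product.Base using (∃; _×_; _,_; proj₁; proj₂)
open import Function.Base using (_∘_; id)
open import Level using (0ℓ)
import Relation.Binary.PropositionalEquality.Core as ≡
open ≡ using (_≡_)
import Relation.Binary.Reasoning.Setoid as SetoidReasoning
open import Relation.Nullary.Decidable using (does; dec-true; dec-false)
open import Relation.Unary using (Pred; Decidable)

-- Algebraic identities in an arbitrary commutative ring.

module RingIdentities {c ℓ} (R : CommutativeRing c ℓ) where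

  open CommutativeRing R
  open GroupProperties +-group using (x≈z//y; //-rightDividesˡ) renaming (∙-cancelʳ to +-cancelʳ)
  open RawSemiringDefinitions (RawRing.rawSemiring rawRing) using (_^_) renaming (_×_ to _·_)
  open RingSolver commutativeSemiring using (solve; con; _:+_; _:*_; _:^_; _:×_; _:=_)
  open SetoidReasoning setoid

  -- Brings a formula for the root, `s ≈ p - l`, into the shape of the theorem. `k` and `l` are kept
  -- apart because one contains `C neq lt` and the other `G 0`.
  subtrahend-swap : ∀ p k l s → k ≈ l → s ≈ p - l → k ≈ p - s
  subtrahend-swap p k l s k≈l s≈p-l = x≈z//y k s p (begin
    k + s          ≈⟨ +-cong k≈l s≈p-l ⟩
    l + (p - l)    ≈⟨ +-comm l (p - l) ⟩
    p - l + l      ≈⟨ //-rightDividesˡ l p ⟩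
    p              ∎)

  -- The difference `s - t` enters as an atom `d` and `s` is rewritten as `d + t`, which leaves an
  -- identity in a commutative semiring.
  squares-agree : ∀ s t → s * s ≈ t * t → (s + t) * (s - t) ≈ 0#
  squares-agree s t s²≈t² = +-cancelʳ (t * t) _ _ (begin
    (s + t) * (s - t) + t * t              ≈⟨ +-congʳ (*-congʳ (+-congʳ (//-rightDividesˡ t s))) ⟨
    ((s - t + t) + t) * (s - t) + t * t    ≈⟨ solve 2 (λ d t → (d :+ t :+ t) :* d :+ t :* t := (d :+ t) :* (d :+ t)) refl (s - t) t ⟩
    (s - t + t) * (s - t + t)              ≈⟨ *-cong (//-rightDividesˡ t s) (//-rightDividesˡ t s) ⟩
    s * s                                  ≈⟨ s²≈t² ⟩
    t * t                                  ≈⟨ +-identityˡ _ ⟨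
    0# + t * t                             ∎)

  -- A solution C of t C² - p C + 1 = 0 gives the root p - 2tC of the discriminant.
  quadratic⇒discriminant : ∀ p t C → p * C ≈ 1# + t * (C * C) →
    (p - 2 · t * C) * (p - 2 · t * C) ≈ p ^ 2 - 4 · t
  -- Adding `4 · t` and `4 · t * (t * (C * C))` to both sides creates the factor `1# + t * (C * C)`,
  -- to which the quadratic equation applies.
  quadratic⇒discriminant p t C quadratic = x≈z//y _ _ _ (+-cancelʳ (4 · t * (t * (C * C))) _ _ (begin
    s * s + 4 · t + 4 · t * (t * (C * C))
      ≈⟨ solve 3 (λ s t C → s :* s :+ 4 :× t :+ 4 :× t :* (t :* (C :* C))
                         := s :* s :+ 4 :× t :* (con 1 :+ t :* (C :* C))) refl s t C ⟩
    s * s + 4 · t * (1# + t * (C * C))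
      ≈⟨ +-congˡ (*-congˡ quadratic) ⟨
    s * s + 4 · t * (p * C)
      ≈⟨ +-congˡ (*-congˡ (*-congʳ p≈s+2tC)) ⟨
    s * s + 4 · t * ((s + 2 · t * C) * C)
      ≈⟨ solve 3 (λ s t C → s :* s :+ 4 :× t :* ((s :+ 2 :× t :* C) :* C)
                         := (s :+ 2 :× t :* C) :^ 2 :+ 4 :× t :* (t :* (C :* C))) refl s t C ⟩
    (s + 2 · t * C) ^ 2 + 4 · t * (t * (C * C))
      ≈⟨ +-congʳ (*-cong p≈s+2tC (*-congʳ p≈s+2tC)) ⟩
    p ^ 2 + 4 · t * (t * (C * C))
      ∎))
    where
    s = p - 2 · t * C
    p≈s+2tC : s + 2 · t * C ≈ p
    p≈s+2tC = //-rightDividesˡ (2 · t * C) p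

  -- The first hypothesis is the equation for G 0 in the linear system.
  system⇒quadratic : ∀ x y C G₁ → C ≈ 1# + x * (C + x * G₁ + y * 0#) → G₁ ≈ C * (1# + x * (y * C)) →
    (1# - x - x ^ 2) * C ≈ 1# + x ^ 3 * y * (C * C)
  -- Adding `(x ^ 2 + x) * C` undoes both subtractions in the coefficient of `C`. In `C-eq`, the
  -- factor `0#` is the empty sum over the letters below 0.
  system⇒quadratic x y C G₁ C-eq G₁-eq = +-cancelʳ ((x ^ 2 + x) * C) _ _ (begin
    p * C + (x ^ 2 + x) * C                   ≈⟨ solve 4 (λ p x z C → p :* C :+ (z :+ x) :* C := (p :+ z :+ x) :* C) refl p x (x ^ 2) C ⟩
    (p + x ^ 2 + x) * C                       ≈⟨ *-congʳ (+-congʳ (//-rightDividesˡ (x ^ 2) (1# - x))) ⟩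
    (1# - x + x) * C                          ≈⟨ *-congʳ (//-rightDividesˡ x 1#) ⟩
    1# * C                                    ≈⟨ *-identityˡ C ⟩
    C                                         ≈⟨ C-eq ⟩
    1# + x * (C + x * G₁ + y * 0#)            ≈⟨ +-congˡ (*-congˡ (+-congʳ (+-congˡ (*-congˡ G₁-eq)))) ⟩
    1# + x * (C + x * (C * (1# + x * (y * C))) + y * 0#)
      ≈⟨ solve 3 (λ x y C → con 1 :+ x :* (C :+ x :* (C :* (con 1 :+ x :* (y :* C))) :+ y :* con 0)
                         := con 1 :+ x :^ 3 :* y :* (C :* C) :+ (x :^ 2 :+ x) :* C) refl x y C ⟩
    1# + x ^ 3 * y * (C * C) + (x ^ 2 + x) * C ∎)
    where p = 1# - x - x ^ 2

  -- The summand `G₀` of the letter 0 moves from the descent sum into the constant term.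
  shift-system : ∀ x y G₀ G G′ S → 1# + x * (G + x * G′ + y * (G₀ + S)) ≈ (1# + x * (y * G₀)) + x * (G + x * G′ + y * S)
  shift-system = solve 6 (λ x y G₀ G G′ S → con 1 :+ x :* (G :+ x :* G′ :+ y :* (G₀ :+ S))
                       := (con 1 :+ x :* (y :* G₀)) :+ x :* (G :+ x :* G′ :+ y :* S)) refl

  -- By linearity, multiplying a solution by `u` only replaces the constant term 1 by `u`.
  scale-system : ∀ x y u G G′ S → (1# + x * (G + x * G′ + y * S)) * u ≈ u + x * (G * u + x * (G′ * u) + y * (S * u))
  scale-system = solve 6 (λ x y u G G′ S → (con 1 :+ x :* (G :+ x :* G′ :+ y :* S)) :* u
                       := u :+ x :* (G :* u :+ x :* (G′ :* u) :+ y :* (S :* u))) refl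

-- The commutative ring of power series over a commutative ring.

module SeriesRing {c ℓ} (R : CommutativeRing c ℓ) where

  open CommutativeRing R
  open RingSolver commutativeSemiring using (solve; con; _:+_; _:*_; _:=_)
  open SetoidReasoning setoid
  open PowerSeries rawRing public using (Series; constant; variable#)
  open PowerSeries rawRing using () renaming (rawRing to seriesRawRing)
  open RawRing seriesRawRing public using ()
    renaming (_≈_ to _≋_; _+_ to _⊕_; _*_ to _⊛_; -_ to ⊝_; 0# to 𝟘; 1# to 𝟙)

  infixl 7 _◃_
  _◃_ : Carrier → Series → Series
  (r ◃ f) n = r * f n

  -- The inductions on n work because (f ⊛ g) (suc n) is, by definition,
  -- f 0 * g (suc n) + ((f ∘ suc) ⊛ g) n.

  -- The bounds `i ≤ n` serve the strong inductions below, where agreement is known only up to some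
  -- degree.
  ⊛-congAt : ∀ n f f′ g g′ → (∀ {i} → i ≤ n → f i ≈ f′ i) → (∀ {i} → i ≤ n → g i ≈ g′ i) →
             (f ⊛ g) n ≈ (f′ ⊛ g′) n
  ⊛-congAt zero    f f′ g g′ p q = +-congʳ (*-cong (p z≤n) (q z≤n))
  ⊛-congAt (suc n) f f′ g g′ p q =
    +-cong (*-cong (p z≤n) (q ≤-refl))
           (⊛-congAt n (f ∘ suc) (f′ ∘ suc) g g′ (p ∘ s≤s) (q ∘ m≤n⇒m≤1+n))

  ⊛-zeroˡ : ∀ n f g → (∀ i → f i ≈ 0#) → (f ⊛ g) n ≈ 0#
  ⊛-zeroˡ zero    f g p = trans (+-identityʳ _) (trans (*-congʳ (p 0)) (zeroˡ _))
  ⊛-zeroˡ (suc n) f g p = begin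
    f 0 * g (suc n) + ((f ∘ suc) ⊛ g) n  ≈⟨ +-cong (*-congʳ (p 0)) (⊛-zeroˡ n (f ∘ suc) g (p ∘ suc)) ⟩
    0# * g (suc n) + 0#                  ≈⟨ +-identityʳ _ ⟩
    0# * g (suc n)                       ≈⟨ zeroˡ _ ⟩
    0#                                   ∎

  constant-⊛ : ∀ r f n → (constant r ⊛ f) n ≈ r * f n
  constant-⊛ r f zero    = +-identityʳ _
  constant-⊛ r f (suc n) = trans (+-congˡ (⊛-zeroˡ n (constant r ∘ suc) f λ _ → refl)) (+-identityʳ _)

  variable-⊛-zero : ∀ f → (variable# ⊛ f) 0 ≈ 0#
  variable-⊛-zero f = trans (+-identityʳ _) (zeroˡ _)

  variable-⊛-suc : ∀ f n → (variable# ⊛ f) (suc n) ≈ f n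
  variable-⊛-suc f n = begin
    0# * f (suc n) + ((variable# ∘ suc) ⊛ f) n  ≈⟨ +-cong (zeroˡ _) (⊛-congAt n _ 𝟙 f f (λ {i} _ → tail i) (λ _ → refl)) ⟩
    0# + (𝟙 ⊛ f) n                              ≈⟨ +-identityˡ _ ⟩
    (𝟙 ⊛ f) n                                   ≈⟨ constant-⊛ 1# f n ⟩
    1# * f n                                    ≈⟨ *-identityˡ _ ⟩
    f n                                         ∎
    where
    tail : ∀ i → variable# (suc i) ≈ 𝟙 i
    tail zero    = refl
    tail (suc i) = refl

  ⊛-distribʳ-⊕ : ∀ h f g → (f ⊕ g) ⊛ h ≋ (f ⊛ h) ⊕ (g ⊛ h)
  ⊛-distribʳ-⊕ h f g zero =
    solve 3 (λ a b c → (a :+ b) :* c :+ con 0 := (a :* c :+ con 0) :+ (b :* c :+ con 0)) refl (f 0) (g 0) (h 0)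
  ⊛-distribʳ-⊕ h f g (suc n) = trans
    (+-congˡ (⊛-distribʳ-⊕ h (f ∘ suc) (g ∘ suc) n))
    (solve 5 (λ a b c d e → (a :+ b) :* c :+ (d :+ e) := (a :* c :+ d) :+ (b :* c :+ e)) refl
      (f 0) (g 0) (h (suc n)) (((f ∘ suc) ⊛ h) n) (((g ∘ suc) ⊛ h) n))

  ◃-⊛-assoc : ∀ r f g → (r ◃ f) ⊛ g ≋ r ◃ (f ⊛ g)
  ◃-⊛-assoc r f g zero = solve 3 (λ a b c → a :* b :* c :+ con 0 := a :* (b :* c :+ con 0)) refl r (f 0) (g 0)
  ◃-⊛-assoc r f g (suc n) = trans
    (+-congˡ (◃-⊛-assoc r (f ∘ suc) g n))
    (solve 4 (λ a b c d → a :* b :* c :+ a :* d := a :* (b :* c :+ d)) refl r (f 0) (g (suc n)) (((f ∘ suc) ⊛ g) n))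

  -- The tail of `f ⊛ g` is `f 0 ◃ (g ∘ suc) ⊕ (f ∘ suc) ⊛ g`, so distributivity and scaling reduce
  -- the claim to the tail of `f`.
  ⊛-assoc : ∀ f g h → (f ⊛ g) ⊛ h ≋ f ⊛ (g ⊛ h)
  ⊛-assoc f g h zero =
    solve 3 (λ a b c → (a :* b :+ con 0) :* c :+ con 0 := a :* (b :* c :+ con 0) :+ con 0) refl (f 0) (g 0) (h 0)
  ⊛-assoc f g h (suc n) = begin
    (f 0 * g 0 + 0#) * h (suc n) + ((f 0 ◃ (g ∘ suc) ⊕ (f ∘ suc) ⊛ g) ⊛ h) n
      ≈⟨ +-congˡ (⊛-distribʳ-⊕ h (f 0 ◃ (g ∘ suc)) ((f ∘ suc) ⊛ g) n) ⟩
    (f 0 * g 0 + 0#) * h (suc n) + ((f 0 ◃ (g ∘ suc) ⊛ h) n + (((f ∘ suc) ⊛ g) ⊛ h) n)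
      ≈⟨ +-congˡ (+-cong (◃-⊛-assoc (f 0) (g ∘ suc) h n) (⊛-assoc (f ∘ suc) g h n)) ⟩
    (f 0 * g 0 + 0#) * h (suc n) + (f 0 * ((g ∘ suc) ⊛ h) n + ((f ∘ suc) ⊛ (g ⊛ h)) n)
      ≈⟨ solve 5 (λ a b c d e → (a :* b :+ con 0) :* c :+ (a :* d :+ e) := a :* (b :* c :+ d) :+ e) refl
           (f 0) (g 0) (h (suc n)) (((g ∘ suc) ⊛ h) n) (((f ∘ suc) ⊛ (g ⊛ h)) n) ⟩
    f 0 * (g 0 * h (suc n) + ((g ∘ suc) ⊛ h) n) + ((f ∘ suc) ⊛ (g ⊛ h)) n
      ∎

  -- Peels the convolution at its other end, which commutativity needs since the defining recursion
  -- peels the left factor.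
  ⊛-suc-last : ∀ f g n → (f ⊛ g) (suc n) ≈ (f ⊛ (g ∘ suc)) n + f (suc n) * g 0
  ⊛-suc-last f g zero =
    solve 4 (λ a b c d → a :* d :+ (b :* c :+ con 0) := (a :* d :+ con 0) :+ b :* c) refl (f 0) (f 1) (g 0) (g 1)
  ⊛-suc-last f g (suc n) = trans (+-congˡ (⊛-suc-last (f ∘ suc) g n)) (sym (+-assoc _ _ _))

  ⊛-comm : ∀ f g → f ⊛ g ≋ g ⊛ f
  ⊛-comm f g zero    = +-congʳ (*-comm _ _)
  ⊛-comm f g (suc n) = begin
    f 0 * g (suc n) + ((f ∘ suc) ⊛ g) n  ≈⟨ +-cong (*-comm _ _) (⊛-comm (f ∘ suc) g n) ⟩
    g (suc n) * f 0 + (g ⊛ (f ∘ suc)) n  ≈⟨ +-comm _ _ ⟩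
    (g ⊛ (f ∘ suc)) n + g (suc n) * f 0  ≈⟨ ⊛-suc-last g f n ⟨
    (g ⊛ f) (suc n)                      ∎

  ⊛-identityˡ : ∀ f → 𝟙 ⊛ f ≋ f
  ⊛-identityˡ f n = trans (constant-⊛ 1# f n) (*-identityˡ _)

  𝟘≈0 : ∀ n → 𝟘 n ≈ 0#
  𝟘≈0 zero    = refl
  𝟘≈0 (suc n) = refl

  ⊕-⊛-isCommutativeRing : IsCommutativeRing _≋_ _⊕_ _⊛_ ⊝_ 𝟘 𝟙
  ⊕-⊛-isCommutativeRing = record
    { isRing = record
      { +-isAbelianGroup = record
        { isGroup = record
          { isMonoid = record
            { isSemigroup = Pt.isSemigroup +-isSemigroup
            ; identity    = (λ f n → trans (+-congʳ (𝟘≈0 n)) (+-identityˡ _))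
                          , (λ f n → trans (+-congˡ (𝟘≈0 n)) (+-identityʳ _))
            }
          ; inverse = (λ f n → trans (-‿inverseˡ _) (sym (𝟘≈0 n)))
                    , (λ f n → trans (-‿inverseʳ _) (sym (𝟘≈0 n)))
          ; ⁻¹-cong = λ p n → -‿cong (p n)
          }
        ; comm = λ f g n → +-comm _ _
        }
      ; *-cong     = ⊛-cong
      ; *-assoc    = ⊛-assoc
      ; *-identity = ⊛-identityˡ , λ f n → trans (⊛-comm f 𝟙 n) (⊛-identityˡ f n)
      ; distrib    = distribˡ′ , ⊛-distribʳ-⊕
      }
    ; *-comm = ⊛-comm
    }
    where
    module Pt = Pointwise ℕ
    ⊛-cong : ∀ {f f′ g g′} → f ≋ f′ → g ≋ g′ → f ⊛ g ≋ f′ ⊛ g′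
    ⊛-cong p q n = ⊛-congAt n _ _ _ _ (λ {i} _ → p i) (λ {i} _ → q i)
    distribˡ′ : ∀ f g h → f ⊛ (g ⊕ h) ≋ (f ⊛ g) ⊕ (f ⊛ h)
    distribˡ′ f g h n = begin
      (f ⊛ (g ⊕ h)) n          ≈⟨ ⊛-comm f (g ⊕ h) n ⟩
      ((g ⊕ h) ⊛ f) n          ≈⟨ ⊛-distribʳ-⊕ f g h n ⟩
      (g ⊛ f) n + (h ⊛ f) n    ≈⟨ +-cong (⊛-comm g f n) (⊛-comm h f n) ⟩
      (f ⊛ g) n + (f ⊛ h) n    ∎

  commutativeRing : CommutativeRing c ℓ
  commutativeRing = record { isCommutativeRing = ⊕-⊛-isCommutativeRing }

  private module S = CommutativeRing commutativeRing
  open S public using () renaming (_-_ to _⊖_)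
  open RawSemiringDefinitions (RawRing.rawSemiring seriesRawRing) public using () renaming (_^_ to _↑_)
  open RingIdentities commutativeRing
  open MonoidSum +-monoid using (sum; sum-cong-≋)
  open MonoidSum S.+-monoid public using () renaming (sum to ∑)

  -- Uniqueness by induction on the degree: square roots and the linear system.

  ∑-coefficient : ∀ {k} (t : Fin k → Series) n → ∑ t n ≈ sum (λ j → t j n)
  ∑-coefficient {zero}  t n = 𝟘≈0 n
  ∑-coefficient {suc k} t n = +-congˡ (∑-coefficient (t ∘ Fin.suc) n)

  ⊛-zeroʳAt : ∀ n f g → (∀ {i} → i ≤ n → g i ≈ 0#) → (f ⊛ g) n ≈ 0#
  ⊛-zeroʳAt n f g g≈0 = begin
    (f ⊛ g) n  ≈⟨ ⊛-congAt n f f g 𝟘 (λ _ → refl) (λ {i} i≤n → trans (g≈0 i≤n) (sym (𝟘≈0 i))) ⟩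
    (f ⊛ 𝟘) n  ≈⟨ S.zeroʳ f n ⟩
    𝟘 n        ≈⟨ 𝟘≈0 n ⟩
    0#         ∎

  -- From `(s + t) * (s - t) ≈ 0` the coefficients of `d` vanish one by one: once the lower ones do,
  -- degree `n` reads `e 0 * d n ≈ 0`, and `e 0` is 2, which can be cancelled.
  sqrt-unique : (∀ r → r + r ≈ 0# → r ≈ 0#) →
                ∀ s t → s 0 ≈ 1# → t 0 ≈ 1# → s ⊛ s ≋ t ⊛ t → s ≋ t
  sqrt-unique torsionFree s t s₀≈1 t₀≈1 s²≈t² n = x∙y⁻¹≈ε⇒x≈y _ _ (d≈0 n)
    where
    open GroupProperties +-group using (x∙y⁻¹≈ε⇒x≈y)
    d e : Series
    d = s ⊖ t
    e = s ⊕ t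

    ed≈0 : ∀ n → (e ⊛ d) n ≈ 0#
    ed≈0 n = trans (squares-agree s t s²≈t² n) (𝟘≈0 n)

    e₀d≈0⇒d≈0 : ∀ {r} → e 0 * r ≈ 0# → r ≈ 0#
    e₀d≈0⇒d≈0 {r} e₀r≈0 = torsionFree r (begin
      r + r            ≈⟨ solve 1 (λ r → r :+ r := (con 1 :+ con 1) :* r) refl r ⟩
      (1# + 1#) * r    ≈⟨ *-congʳ (+-cong s₀≈1 t₀≈1) ⟨
      e 0 * r          ≈⟨ e₀r≈0 ⟩
      0#               ∎)

    step : ∀ n → (∀ {m} → m < n → d m ≈ 0#) → d n ≈ 0#
    step zero    ih = e₀d≈0⇒d≈0 (trans (sym (+-identityʳ _)) (ed≈0 0))
    step (suc n) ih = e₀d≈0⇒d≈0 (begin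
      e 0 * d (suc n)                        ≈⟨ +-identityʳ _ ⟨
      e 0 * d (suc n) + 0#                   ≈⟨ +-congˡ (⊛-zeroʳAt n (e ∘ suc) d (ih ∘ s≤s)) ⟨
      e 0 * d (suc n) + ((e ∘ suc) ⊛ d) n    ≈⟨ ed≈0 (suc n) ⟩
      0#                                     ∎)

    d≈0 : ∀ n → d n ≈ 0#
    d≈0 = <-rec (λ n → d n ≈ 0#) step

  -- With `G` for `X`, the first two summands make up `F a`, and `v` is the variable that marks
  -- descents.
  rhs : Series → (ℕ → Series) → ℕ → Series
  rhs v X a = X a ⊕ variable# ⊛ X (suc a) ⊕ v ⊛ ∑ {a} (X ∘ toℕ)

  -- The constant term `u` is a parameter because `G` solves the system for `𝟙`, while its shift is
  -- identified in the system for `1 + x v G 0`.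
  Solves : Series → Series → (ℕ → Series) → Set ℓ
  Solves u v X = ∀ a → X a ≋ u ⊕ variable# ⊛ rhs v X a

  -- Multiplication by x raises degrees by one, hence the strict bound; this is why the system
  -- determines its solution.
  variable-⊛-congAt : ∀ n f g → (∀ {i} → i < n → f i ≈ g i) → (variable# ⊛ f) n ≈ (variable# ⊛ g) n
  variable-⊛-congAt zero    f g f≈g = trans (variable-⊛-zero f) (sym (variable-⊛-zero g))
  variable-⊛-congAt (suc n) f g f≈g = begin
    (variable# ⊛ f) (suc n)  ≈⟨ variable-⊛-suc f n ⟩
    f n                      ≈⟨ f≈g ≤-refl ⟩
    g n                      ≈⟨ variable-⊛-suc g n ⟨
    (variable# ⊛ g) (suc n)  ∎

  -- The equation for `X a` involves `X (suc a)`, so the induction runs over the degree, for all `a`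
  -- at once: behind the outer factor x only lower coefficients occur.
  solution-unique : ∀ {u v X Y} → Solves u v X → Solves u v Y → ∀ a → X a ≋ Y a
  solution-unique {u} {v} {X} {Y} X-solves Y-solves a n = <-rec (λ n → ∀ a → X a n ≈ Y a n) step n a
    where
    step : ∀ n → (∀ {m} → m < n → ∀ a → X a m ≈ Y a m) → ∀ a → X a n ≈ Y a n
    step n ih a = begin
      X a n  ≈⟨ X-solves a n ⟩
      _      ≈⟨ +-congˡ (variable-⊛-congAt n (rhs v X a) (rhs v Y a) λ {i} i<n →
                  +-cong (+-cong (ih i<n a)
                                 (variable-⊛-congAt i (X (suc a)) (Y (suc a)) λ j<i → ih (<-trans j<i i<n) (suc a)))
                         (⊛-congAt i v v (∑ {a} (X ∘ toℕ)) (∑ {a} (Y ∘ toℕ)) (λ _ → refl) λ {j} j≤i → begin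
                           ∑ {a} (X ∘ toℕ) j             ≈⟨ ∑-coefficient {a} (X ∘ toℕ) j ⟩
                           sum {a} (λ k → X (toℕ k) j)   ≈⟨ sum-cong-≋ {a} (λ k → ih (≤-<-trans j≤i i<n) (toℕ k)) ⟩
                           sum {a} (λ k → Y (toℕ k) j)   ≈⟨ ∑-coefficient {a} (Y ∘ toℕ) j ⟨
                           ∑ {a} (Y ∘ toℕ) j             ∎)) ⟩
      _      ≈⟨ Y-solves a n ⟨
      Y a n  ∎

  -- Both sides solve the system with 𝟙 replaced by 1 + x v G₀.
  shifted-solution : ∀ {v G} → Solves 𝟙 v G → ∀ a → G (suc a) ≋ G a ⊛ (𝟙 ⊕ variable# ⊛ (v ⊛ G 0))
  shifted-solution {v} {G} G-solves = solution-unique {u} {v} {G ∘ suc} {λ a → G a ⊛ u} shifted scaled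
    where
    u : Series
    u = 𝟙 ⊕ variable# ⊛ (v ⊛ G 0)

    shifted : Solves u v (G ∘ suc)
    -- The sum over `suc a` letters unfolds to `G 0` plus the sum of the shifted family.
    shifted a = S.trans (G-solves (suc a))
                        (shift-system variable# v (G 0) (G (suc a)) (G (suc (suc a))) (∑ {a} (G ∘ suc ∘ toℕ)))

    scaled : Solves u v (λ a → G a ⊛ u)
    scaled a = S.trans (S.*-congʳ {u} (G-solves a)) (S.trans
      (scale-system variable# v u (G a) (G (suc a)) (∑ {a} (G ∘ toℕ)))
      (S.+-congˡ {u} (S.*-congˡ {variable#} (S.+-congˡ {G a ⊛ u ⊕ variable# ⊛ (G (suc a) ⊛ u)} (S.*-congˡ {v}
        (SemiringSum.*-distribʳ-sum S.semiring {a} u (G ∘ toℕ)))))))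

-- Enumeration of the avoiding words, with a ring element `q` marking descents.

module Enumeration {c ℓ} (R : CommutativeRing c ℓ) (q : CommutativeRing.Carrier R) where

  open CommutativeRing R
  open RawSemiringDefinitions (RawRing.rawSemiring rawRing) using (_^_)
  open SemiringSum semiring using (sum; *-distribˡ-sum)
  open SeriesRing R
  open SetoidReasoning setoid

  total : ∀ {a} {A : Set a} → (A → Carrier) → List A → Carrier
  total f = foldr (λ w s → f w + s) 0#

  module _ {a} {A : Set a} where

    total-cong : ∀ {f g : A → Carrier} → (∀ w → f w ≈ g w) → ∀ ws → total f ws ≈ total g ws
    total-cong f≈g []       = refl
    total-cong f≈g (w ∷ ws) = +-cong (f≈g w) (total-cong f≈g ws)

    total-* : ∀ r (f : A → Carrier) ws → total (λ w → r * f w) ws ≈ r * total f ws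
    total-* r f []       = sym (zeroʳ r)
    total-* r f (w ∷ ws) = trans (+-congˡ (total-* r f ws)) (sym (distribˡ r _ _))

    total-0 : ∀ (ws : List A) → total (λ _ → 0#) ws ≈ 0#
    total-0 []       = refl
    total-0 (w ∷ ws) = trans (+-identityˡ _) (total-0 ws)

    total-++ : ∀ (f : A → Carrier) vs ws → total f (vs ++ ws) ≈ total f vs + total f ws
    total-++ f []       ws = sym (+-identityˡ _)
    total-++ f (v ∷ vs) ws = trans (+-congˡ (total-++ f vs ws)) (sym (+-assoc _ _ _))

    total-map : ∀ {b} {B : Set b} (f : A → Carrier) (g : B → A) ws → total f (map g ws) ≈ total (f ∘ g) ws
    total-map f g []       = refl
    total-map f g (w ∷ ws) = +-congˡ (total-map f g ws)

    total-concatMap : ∀ {b} {B : Set b} (f : A → Carrier) (g : B → List A) ws →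
                      total f (concatMap g ws) ≈ total (total f ∘ g) ws
    total-concatMap f g []       = refl
    total-concatMap f g (w ∷ ws) = trans (total-++ f (g w) _) (+-congˡ (total-concatMap f g ws))

    total-filter : ∀ {p} {P : Pred A p} (P? : Decidable P) (f : A → Carrier) ws →
                   total f (filter P? ws) ≈ total (λ w → if does (P? w) then f w else 0#) ws
    total-filter P? f []       = refl
    total-filter P? f (w ∷ ws) with does (P? w)
    ... | true  = +-congˡ (total-filter P? f ws)
    ... | false = trans (total-filter P? f ws) (sym (+-identityˡ _))

  total-applyUpTo : ∀ (f g : ℕ → Carrier) (h : ℕ → ℕ) n → (∀ {i} → i < n → f (h i) ≈ g i) →
                    total f (applyUpTo h n) ≈ sum {n} (g ∘ toℕ)
  total-applyUpTo f g h zero    p = refl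
  total-applyUpTo f g h (suc n) p = +-cong (p z<s) (total-applyUpTo f (g ∘ suc) (h ∘ suc) n (p ∘ s<s))

  total-upTo-suc : ∀ f n → total f (upTo (suc n)) ≈ total f (upTo n) + f n
  total-upTo-suc f n = begin
    total f (upTo (suc n))            ≡⟨ ≡.cong (total f) (upTo-∷ʳ n) ⟨
    total f (upTo n ++ [ n ])         ≈⟨ total-++ f (upTo n) [ n ] ⟩
    total f (upTo n) + (f n + 0#)     ≈⟨ +-congˡ (+-identityʳ _) ⟩
    total f (upTo n) + f n            ∎

  -- Effect of the first step of a word on its weight.

  weight : Word → Carrier
  weight w = if does (avoids? neq lt w) then q ^ des w else 0#

  -- The weight of w when it is preceded by a letter other than its
  -- first one, so that it may not begin with an ascent.
  restrictedWeight : Word → Carrier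
  restrictedWeight (a ∷ b ∷ w) = if does (a <? b) then 0# else weight (a ∷ b ∷ w)
  restrictedWeight w           = weight w

  -- A repeated letter is no descent, and it starts no occurrence of the pattern since `neq` fails.
  weight-flat : ∀ a w → weight (a ∷ a ∷ w) ≈ weight (a ∷ w)
  weight-flat a [] rewrite dec-false (a <? a) (<-irrefl ≡.refl) = refl
  weight-flat a (c ∷ w) rewrite dec-true (a ≟ a) ≡.refl | dec-false (a <? a) (<-irrefl ≡.refl) = refl

  -- The step satisfies `neq`, so an occurrence starts here exactly when the next step is an ascent,
  -- the case in which `restrictedWeight` vanishes.
  weight-ascent : ∀ {a b} w → a < b → weight (a ∷ b ∷ w) ≈ restrictedWeight (b ∷ w)
  weight-ascent {a} {b} [] a<b rewrite dec-false (b <? a) (<-asym a<b) = refl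
  weight-ascent {a} {b} (c ∷ w) a<b
    rewrite dec-false (b <? a) (<-asym a<b) | dec-false (a ≟ b) (<⇒≢ a<b)
    with does (b <? c)
  ... | true  = refl
  ... | false = refl

  -- As for an ascent, with one descent more; in the cases where the word contains the pattern, both
  -- sides are zero.
  weight-descent : ∀ {a b} w → b < a → weight (a ∷ b ∷ w) ≈ q * restrictedWeight (b ∷ w)
  weight-descent {a} {b} [] b<a rewrite dec-true (b <? a) b<a = refl
  weight-descent {a} {b} (c ∷ w) b<a
    rewrite dec-true (b <? a) b<a | dec-false (a ≟ b) (>⇒≢ b<a)
    with does (b <? c)
  ... | true  = sym (zeroʳ q)
  ... | false with does (contains? neq lt (b ∷ c ∷ w))
  ...   | true  = sym (zeroʳ q)
  ...   | false = refl

  restrictedWeight-nonAscent : ∀ {a b} w → a ≮ b → restrictedWeight (a ∷ b ∷ w) ≈ weight (a ∷ b ∷ w)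
  restrictedWeight-nonAscent {a} {b} w a≮b =
    reflexive (≡.cong (λ c → if c then 0# else weight (a ∷ b ∷ w)) (dec-false (a <? b) a≮b))

  restrictedWeight-flat : ∀ a w → restrictedWeight (a ∷ a ∷ w) ≈ weight (a ∷ w)
  restrictedWeight-flat a w = trans (restrictedWeight-nonAscent w (<-irrefl ≡.refl)) (weight-flat a w)

  restrictedWeight-ascent : ∀ {a b} w → a < b → restrictedWeight (a ∷ b ∷ w) ≈ 0#
  restrictedWeight-ascent {a} {b} w a<b =
    reflexive (≡.cong (λ c → if c then 0# else weight (a ∷ b ∷ w)) (dec-true (a <? b) a<b))

  restrictedWeight-descent : ∀ {a b} w → b < a → restrictedWeight (a ∷ b ∷ w) ≈ q * restrictedWeight (b ∷ w)
  restrictedWeight-descent w b<a = trans (restrictedWeight-nonAscent w (<-asym b<a)) (weight-descent w b<a)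

  -- Recurrences for the continuations of a given letter.

  F G : ℕ → Series
  F a n = total (weight ∘ (a ∷_)) (continuations a n)
  G a n = total (restrictedWeight ∘ (a ∷_)) (continuations a n)

  descents : ℕ → ℕ → Carrier
  descents a n = sum {a} (λ b → q * G (toℕ b) n)

  module _ (f : Word → Carrier) (a n : ℕ) where

    branch : ℕ → Carrier
    branch b = total (f ∘ (b ∷_)) (continuations b n)

    -- The growth condition allows the next letters `b < a`, `a` and `suc a`. Leaving `f` general
    -- lets the splitting serve both `F` and `G`.
    total-continuations : (∀ {b} w → b < a → f (b ∷ w) ≈ q * restrictedWeight (b ∷ w)) →
                          total f (continuations a (suc n)) ≈ descents a n + branch a + branch (suc a)
    total-continuations f-descent = begin
      total f (continuations a (suc n))
        ≈⟨ total-concatMap f (λ b → map (b ∷_) (continuations b n)) (upTo (2 ℕ.+ a)) ⟩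
      total (λ b → total f (map (b ∷_) (continuations b n))) (upTo (2 ℕ.+ a))
        ≈⟨ total-cong (λ b → total-map f (b ∷_) (continuations b n)) (upTo (2 ℕ.+ a)) ⟩
      total branch (upTo (2 ℕ.+ a))
        ≈⟨ total-upTo-suc branch (suc a) ⟩
      total branch (upTo (suc a)) + branch (suc a)
        ≈⟨ +-congʳ (total-upTo-suc branch a) ⟩
      total branch (upTo a) + branch a + branch (suc a)
        ≈⟨ +-congʳ (+-congʳ (total-applyUpTo branch (λ b → q * G b n) id a λ {b} b<a →
             trans (total-cong (λ w → f-descent w b<a) (continuations b n))
                   (total-* q (restrictedWeight ∘ (b ∷_)) (continuations b n)))) ⟩
      descents a n + branch a + branch (suc a)
        ∎

  F-suc : ∀ a n → F a (suc n) ≈ descents a n + F a n + G (suc a) n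
  F-suc a n = trans (total-continuations (weight ∘ (a ∷_)) a n weight-descent)
    (+-cong (+-congˡ (total-cong (weight-flat a) (continuations a n)))
            (total-cong (λ w → weight-ascent w ≤-refl) (continuations (suc a) n)))

  G-suc : ∀ a n → G a (suc n) ≈ descents a n + F a n
  G-suc a n = begin
    G a (suc n)
      ≈⟨ total-continuations (restrictedWeight ∘ (a ∷_)) a n restrictedWeight-descent ⟩
    descents a n + _ + _
      ≈⟨ +-cong (+-congˡ (total-cong (restrictedWeight-flat a) (continuations a n)))
                (trans (total-cong (λ w → restrictedWeight-ascent {a} w ≤-refl) (continuations (suc a) n))
                       (total-0 (continuations (suc a) n))) ⟩
    descents a n + F a n + 0#
      ≈⟨ +-identityʳ _ ⟩
    descents a n + F a n
      ∎

  -- The recurrences differ only in the ascent branch; in degree 0 both count the empty continuation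
  -- with the same weight.
  F≈G+xG : ∀ a n → F a n ≈ G a n + (variable# ⊛ G (suc a)) n
  F≈G+xG a zero    = sym (trans (+-congˡ (variable-⊛-zero (G (suc a)))) (+-identityʳ _))
  F≈G+xG a (suc n) = begin
    F a (suc n)                                     ≈⟨ F-suc a n ⟩
    descents a n + F a n + G (suc a) n              ≈⟨ +-cong (G-suc a n) (variable-⊛-suc (G (suc a)) n) ⟨
    G a (suc n) + (variable# ⊛ G (suc a)) (suc n)   ∎

  G-solves : Solves 𝟙 (constant q) G
  -- The empty continuation contributes `q ^ 0`, which is the constant term of `𝟙`.
  G-solves a zero    = +-congˡ (sym (variable-⊛-zero (rhs (constant q) G a)))
  G-solves a (suc n) = begin
    G a (suc n)
      ≈⟨ G-suc a n ⟩
    descents a n + F a n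
      ≈⟨ +-comm _ _ ⟩
    F a n + descents a n
      ≈⟨ +-cong (F≈G+xG a n) (sym (begin
           (constant q ⊛ ∑ {a} (G ∘ toℕ)) n    ≈⟨ constant-⊛ q (∑ {a} (G ∘ toℕ)) n ⟩
           q * ∑ {a} (G ∘ toℕ) n               ≈⟨ *-congˡ (∑-coefficient {a} (G ∘ toℕ) n) ⟩
           q * sum {a} (λ b → G (toℕ b) n)     ≈⟨ *-distribˡ-sum {a} q (λ b → G (toℕ b) n) ⟩
           descents a n                        ∎)) ⟩
    rhs (constant q) G a n
      ≈⟨ variable-⊛-suc (rhs (constant q) G a) n ⟨
    (variable# ⊛ rhs (constant q) G a) (suc n)
      ≈⟨ +-identityˡ _ ⟨
    0# + (variable# ⊛ rhs (constant q) G a) (suc n)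
      ∎

  -- The degree of `F` and `G` does not count the leading letter, so words of length `suc n` are
  -- counted by `F 0 n`. This is `G 0 (suc n)`, as there are no letters below 0 and the descent sum
  -- is empty.
  avoiders≈G₀ : ∀ n → total (λ w → q ^ des w) (filter (avoids? neq lt) (catalanWords n)) ≈ G 0 n
  avoiders≈G₀ zero    = refl
  avoiders≈G₀ (suc n) = begin
    total (λ w → q ^ des w) (filter (avoids? neq lt) (catalanWords (suc n)))
      ≈⟨ total-filter (avoids? neq lt) (λ w → q ^ des w) (catalanWords (suc n)) ⟩
    total weight (map (0 ∷_) (continuations 0 n))
      ≈⟨ total-map weight (0 ∷_) (continuations 0 n) ⟩
    F 0 n
      ≈⟨ +-identityˡ _ ⟨
    0# + F 0 n
      ≈⟨ G-suc 0 n ⟨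
    G 0 (suc n)
      ∎

  G₀-quadratic : let x = variable#; y = constant q in
                 (𝟙 ⊖ x ⊖ x ↑ 2) ⊛ G 0 ≋ 𝟙 ⊕ x ↑ 3 ⊛ y ⊛ (G 0 ⊛ G 0)
  G₀-quadratic = RingIdentities.system⇒quadratic commutativeRing variable# (constant q) (G 0) (G 1)
    (G-solves 0) (shifted-solution {constant q} {G} G-solves 0)

-- The ring of integer polynomials, embedded into series by coefficients.

coeff-+ₚ : ∀ p q k → coeff (p +ₚ q) k ≡ coeff p k ℤ.+ coeff q k
coeff-+ₚ []      q       k       = ≡.sym (ℤ.+-identityˡ _)
coeff-+ₚ (a ∷ p) []      k       = ≡.sym (ℤ.+-identityʳ _)
coeff-+ₚ (a ∷ p) (b ∷ q) zero    = ≡.refl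
coeff-+ₚ (a ∷ p) (b ∷ q) (suc k) = coeff-+ₚ p q k

coeff-map : ∀ {f : ℤ → ℤ} → f 0ℤ ≡ 0ℤ → ∀ p k → coeff (map f p) k ≡ f (coeff p k)
coeff-map f0≡0 []      k       = ≡.sym f0≡0
coeff-map f0≡0 (a ∷ p) zero    = ≡.refl
coeff-map f0≡0 (a ∷ p) (suc k) = coeff-map f0≡0 p k

module ℤ⟦y⟧ = SeriesRing ℤ.+-*-commutativeRing

-- Both products peel the first coefficient of the left factor, so their recursions match.
coeff-*ₚ : ∀ p q k → coeff (p *ₚ q) k ≡ (coeff p ℤ⟦y⟧.⊛ coeff q) k
coeff-*ₚ []      q k = ≡.sym (ℤ⟦y⟧.⊛-zeroˡ k (coeff []) (coeff q) λ _ → ≡.refl)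
coeff-*ₚ (a ∷ p) q k = ≡.trans (coeff-+ₚ (map (a ℤ.*_) q) (0ℤ ∷ (p *ₚ q)) k)
  (≡.trans (≡.cong (ℤ._+ coeff (0ℤ ∷ (p *ₚ q)) k) (coeff-map (ℤ.*-zeroʳ a) q k)) (tail k))
  where
  tail : ∀ k → a ℤ.* coeff q k ℤ.+ coeff (0ℤ ∷ (p *ₚ q)) k ≡ (coeff (a ∷ p) ℤ⟦y⟧.⊛ coeff q) k
  tail zero    = ≡.refl
  tail (suc k) = ≡.cong (λ c → a ℤ.* coeff q (suc k) ℤ.+ c) (coeff-*ₚ p q k)

-- Transfers the ring laws from series to coefficient lists. Equality of polynomials is equality of
-- coefficients, so congruence and injectivity are both `id`.
coeff-isRingMonomorphism : IsRingMonomorphism ℤ[y] (CommutativeRing.rawRing ℤ⟦y⟧.commutativeRing) coeff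
coeff-isRingMonomorphism = record
  { isRingHomomorphism = record
    { isSemiringHomomorphism = record
      { isNearSemiringHomomorphism = record
        { +-isMonoidHomomorphism = record
          { isMagmaHomomorphism = record
            { isRelHomomorphism = record { cong = id }
            ; homo = coeff-+ₚ
            }
          ; ε-homo = λ { zero → ≡.refl ; (suc k) → ≡.refl }
          }
        ; *-homo = coeff-*ₚ
        }
      ; 1#-homo = λ { zero → ≡.refl ; (suc k) → ≡.refl }
      }
    ; -‿homo = coeff-map ≡.refl
    }
  ; injective = id
  }

polynomialRing : CommutativeRing 0ℓ 0ℓ
polynomialRing = record
  { isCommutativeRing = RingMonomorphism.isCommutativeRing coeff-isRingMonomorphism
      (CommutativeRing.isCommutativeRing ℤ⟦y⟧.commutativeRing)
  }

-- For any other form of `i`, the sum `i ℤ.+ i` computes to a visibly nonzero integer.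
i+i≡0⇒i≡0 : ∀ i → i ℤ.+ i ≡ 0ℤ → i ≡ 0ℤ
i+i≡0⇒i≡0 (ℤ.+ zero) _ = ≡.refl

-- Existence and uniqueness of the root, and the closed form.

open import Defs
open Enumeration polynomialRing indeterminate using (G; G₀-quadratic; avoiders≈G₀)
module ℤ[y]⟦x⟧-Ring = SeriesRing polynomialRing

theorem3p42 : let D = (1# - x - x ^ 2) ^ 2 - 4 · (x ^ 3 * y) in
    (∃ λ √D → IsSqrt √D D) ×
    (∀ √D → IsSqrt √D D → 2 · (x ^ 3 * y) * C neq lt ≈ 1# - x - x ^ 2 - √D)
theorem3p42 = (r , r-isSqrt) , λ √D (√D₀≈1 , √D²≈D) →
  R.subtrahend-swap p (2 · t * C neq lt) (2 · t * G 0) √D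
    (CommutativeRing.*-congˡ ℤ[y]⟦x⟧-Ring.commutativeRing {2 · t} {C neq lt} {G 0} avoiders≈G₀)
    -- An arbitrary root with constant term 1 is identified with the explicit root `r`.
    (ℤ[y]⟦x⟧-Ring.sqrt-unique torsionFree √D r √D₀≈1 (proj₁ r-isSqrt)
      λ n k → ≡.trans (√D²≈D n k) (≡.sym (proj₂ r-isSqrt n k)))
  where
  module R = RingIdentities ℤ[y]⟦x⟧-Ring.commutativeRing

  p t r : Series
  p = 1# - x - x ^ 2
  t = x ^ 3 * y
  r = p - 2 · t * G 0

  r-isSqrt : IsSqrt r (p ^ 2 - 4 · t)
  -- The constant term of `r` computes to 1, since `x` has none and `t` is a multiple of `x`.
  r-isSqrt = (λ _ → ≡.refl) , R.quadratic⇒discriminant p t (G 0) G₀-quadratic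

  torsionFree : ∀ r → (∀ k → coeff (r +ₚ r) k ≡ 0ℤ) → ∀ k → coeff r k ≡ 0ℤ
  torsionFree r 2r≈0 k = i+i≡0⇒i≡0 (coeff r k) (≡.trans (≡.sym (coeff-+ₚ r r k)) (2r≈0 k))
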